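{- Let $(C,e,\lambda,\oplus)$ be the free Catalan structure, and let $M=h\circ\mathrm{rev}\colon C\to C$, with $h$ and $\mathrm{rev}$ as defined in the context. Then $M$ is invertible and $M^{ -1}=\mathrm{rev}\circ M\circ\mathrm{rev}$. In particular, $M$ is conjugate to its own inverse by $\mathrm{rev}$.
   Context: A Catalan structure is a quadruple $(C,e,\lambda,\oplus)$ where $C=\bigsqcup_{n\ge 0}C_n$ with $C_0=\{e\}$ ($|t|=n$ for $t\in C_n$), $\lambda\colon C_n\to C_{n+1}$, $\oplus\colon C_m\times C_n\to C_{m+n}$, $\oplus$ is associative with two-sided identity $e$, and every $t\in C$ can be written uniquely in exactly one of three forms: $t=e$; $t=\lambda(s)$ with $s\in C$ (indecomposable); $t=u\oplus v$ with $u$ indecomposable and $v\in C\setminus C_0$ (decomposable). Hence every nonempty $t$ is uniquely $\lambda(u)\oplus v$ ($v=e$ allowed). The free Catalan structure is realized by the formal expressions $e$, $\lambda(t)$, $\lambda(u)\oplus v$ with $v\ne e$; it is isomorphic to rooted plane trees written as lists of children, with $e=[\,]$, $\lambda(T)=[T]$, $\oplus$ = concatenation of child lists. Put $\gamma(t)=t\oplus\lambda(e)$ and define $\ominus$ by $e\ominus v=v$, $\lambda(u)\ominus v=\lambda(u\ominus v)$, $(t\oplus u)\ominus v=t\oplus(u\ominus v)$ for $t,u\ne e$ (well defined; one may take $t$ indecomposable). The maps: $h(e)=e$, $h(\lambda(u)\oplus v)=h(v)\ominus\gamma(h(u))$; $\mathrm{rev}(e)=e$, $\mathrm{rev}(\lambda(u)\oplus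 v)=\mathrm{rev}(v)\oplus\lambda(\mathrm{rev}(u))$. -}

module Defs where

open import Level using (Level)
open import Data.Nat using (ℕ; suc; _+_)
open import Data.Nat.Properties using (+-assoc; +-identityʳ)
open import Data.Product using (_×_; _,_; ∃; ∃₂)
open import Data.Sum using (_⊎_; inj₁; inj₂)
open import Data.Empty using (⊥-elim)
open import Function using (_∘_; _⇔_; mk⇔)
open import Relation.Binary.PropositionalEquality
  using (_≡_; _≢_; _≗_; refl; sym; trans; cong; cong₂)

-- C = ⨆ Cₙ is given by a carrier and a degree function, Cₙ being the
-- elements of degree n.  The last fields say that every element has one of
-- the forms e, λ(s), λ(u) ⊕ v with v ≠ e, that the three forms are mutually
-- exclusive, and that s, u, v are unique.
record CatalanStructure (ℓ : Level) : Set (Level.suc ℓ) where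
  infixr 6 _⊕_
  field
    C    : Set ℓ
    ∣_∣  : C → ℕ
    e    : C
    lam  : C → C
    _⊕_  : C → C → C

    degree-zero : ∀ t → ∣ t ∣ ≡ 0 ⇔ t ≡ e
    degree-lam  : ∀ t → ∣ lam t ∣ ≡ suc ∣ t ∣
    degree-⊕    : ∀ t u → ∣ t ⊕ u ∣ ≡ ∣ t ∣ + ∣ u ∣

    ⊕-assoc     : ∀ t u v → (t ⊕ u) ⊕ v ≡ t ⊕ (u ⊕ v)
    ⊕-identityˡ : ∀ t → e ⊕ t ≡ t
    ⊕-identityʳ : ∀ t → t ⊕ e ≡ t

    form : ∀ t → t ≡ e
               ⊎ (∃ λ s → t ≡ lam s)
               ⊎ (∃₂ λ u v → v ≢ e × t ≡ lam u ⊕ v)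
    e≢lam         : ∀ s → e ≢ lam s
    e≢lam⊕        : ∀ u v → v ≢ e → e ≢ lam u ⊕ v
    lam≢lam⊕      : ∀ s u v → v ≢ e → lam s ≢ lam u ⊕ v
    lam-injective : ∀ s s′ → lam s ≡ lam s′ → s ≡ s′
    lam⊕-injective : ∀ u v u′ v′ → v ≢ e → v′ ≢ e →
                     lam u ⊕ v ≡ lam u′ ⊕ v′ → u ≡ u′ × v ≡ v′

infixr 6 _◂_ _⊕_
infixr 6 _⊖_

-- The free Catalan structure.  The formal expressions λ(u) and λ(u) ⊕ v
-- (v ≠ e) are both represented by _◂_, as u ◂ e and u ◂ v; as a plane tree,
-- u ◂ v has u as first child, followed by the children of v.
data Tree : Set where
  e   : Tree
  _◂_ : Tree → Tree → Tree

∣_∣ : Tree → ℕ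
∣ e ∣     = 0
∣ u ◂ v ∣ = suc ∣ u ∣ + ∣ v ∣

lam : Tree → Tree
lam t = t ◂ e

_⊕_ : Tree → Tree → Tree
e       ⊕ t = t
(u ◂ v) ⊕ t = u ◂ (v ⊕ t)

γ : Tree → Tree
γ t = t ⊕ lam e

_⊖_ : Tree → Tree → Tree
e             ⊖ v = v
(u ◂ e)       ⊖ v = lam (u ⊖ v)
(u ◂ (w ◂ x)) ⊖ v = lam u ⊕ ((w ◂ x) ⊖ v)

h : Tree → Tree
h e       = e
h (u ◂ v) = h v ⊖ γ (h u)

rev : Tree → Tree
rev e       = e
rev (u ◂ v) = rev v ⊕ lam (rev u)

M : Tree → Tree
M = h ∘ rev

⊕-assoc : ∀ t u v → (t ⊕ u) ⊕ v ≡ t ⊕ (u ⊕ v)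
⊕-assoc e       u v = refl
⊕-assoc (s ◂ t) u v = cong (s ◂_) (⊕-assoc t u v)

⊕-identityʳ : ∀ t → t ⊕ e ≡ t
⊕-identityʳ e       = refl
⊕-identityʳ (s ◂ t) = cong (s ◂_) (⊕-identityʳ t)

degree-⊕ : ∀ t u → ∣ t ⊕ u ∣ ≡ ∣ t ∣ + ∣ u ∣
degree-⊕ e       u = refl
degree-⊕ (s ◂ t) u =
  cong suc (trans (cong (∣ s ∣ +_) (degree-⊕ t u))
                  (sym (+-assoc (∣ s ∣) (∣ t ∣) (∣ u ∣))))

-- The clauses of _⊖_ split off one indecomposable summand; this is the
-- defining equation for arbitrary nonempty t and u.
⊖-⊕ : ∀ t u v → t ≢ e → u ≢ e → (t ⊕ u) ⊖ v ≡ t ⊕ (u ⊖ v)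
⊖-⊕ e             u       v t≢e u≢e = ⊥-elim (t≢e refl)
⊖-⊕ (s ◂ e)       e       v t≢e u≢e = ⊥-elim (u≢e refl)
⊖-⊕ (s ◂ e)       (_ ◂ _) v t≢e u≢e = refl
⊖-⊕ (s ◂ (w ◂ x)) u       v t≢e u≢e =
  cong (s ◂_) (⊖-⊕ (w ◂ x) u v (λ ()) u≢e)

Free : CatalanStructure Level.zero
Free = record
  { C = Tree ; ∣_∣ = ∣_∣ ; e = e ; lam = lam ; _⊕_ = _⊕_
  ; degree-zero    = λ t → mk⇔ (only-e t) λ { refl → refl }
  ; degree-lam     = λ t → degree-lam t
  ; degree-⊕       = degree-⊕
  ; ⊕-assoc        = ⊕-assoc
  ; ⊕-identityˡ    = λ _ → refl
  ; ⊕-identityʳ    = ⊕-identityʳ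
  ; form           = form
  ; e≢lam          = λ _ ()
  ; e≢lam⊕         = λ _ _ _ ()
  ; lam≢lam⊕       = λ { _ _ _ v≢e refl → v≢e refl }
  ; lam-injective  = λ { _ _ refl → refl }
  ; lam⊕-injective = λ { _ _ _ _ _ _ refl → refl , refl }
  }
  where
  only-e : ∀ t → ∣ t ∣ ≡ 0 → t ≡ e
  only-e e _ = refl

  degree-lam : ∀ t → ∣ lam t ∣ ≡ suc ∣ t ∣
  degree-lam t = cong suc (+-identityʳ ∣ t ∣)

  form : ∀ t → t ≡ e
             ⊎ (∃ λ s → t ≡ lam s)
             ⊎ (∃₂ λ u v → v ≢ e × t ≡ lam u ⊕ v)
  form e             = inj₁ refl
  form (u ◂ e)       = inj₂ (inj₁ (u , refl))
  form (u ◂ (w ◂ x)) = inj₂ (inj₂ (u , w ◂ x , (λ ()) , refl))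

-- Freeness: there is exactly one homomorphism from Tree to any Catalan
-- structure (it automatically preserves degrees).
module _ {ℓ} (D : CatalanStructure ℓ) where
  private module D = CatalanStructure D

  record IsHomomorphism (f : Tree → D.C) : Set ℓ where
    field
      e-homo   : f e ≡ D.e
      lam-homo : ∀ t → f (lam t) ≡ D.lam (f t)
      ⊕-homo   : ∀ t u → f (t ⊕ u) ≡ f t D.⊕ f u

  fold : Tree → D.C
  fold e       = D.e
  fold (u ◂ v) = D.lam (fold u) D.⊕ fold v

  fold-isHomomorphism : IsHomomorphism fold
  fold-isHomomorphism = record
    { e-homo   = refl
    ; lam-homo = λ t → D.⊕-identityʳ _
    ; ⊕-homo   = ⊕-homo
    }
    where
    ⊕-homo : ∀ t u → fold (t ⊕ u) ≡ fold t D.⊕ fold u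
    ⊕-homo e       u = sym (D.⊕-identityˡ _)
    ⊕-homo (s ◂ t) u =
      trans (cong (D.lam (fold s) D.⊕_) (⊕-homo t u)) (sym (D.⊕-assoc _ _ _))

  fold-unique : ∀ f → IsHomomorphism f → f ≗ fold
  fold-unique f f-homo = go
    where
    open IsHomomorphism f-homo
    go : f ≗ fold
    go e       = e-homo
    go (u ◂ v) =
      trans (⊕-homo (lam u) v)
            (cong₂ D._⊕_ (trans (lam-homo u) (cong D.lam (go u))) (go v))

{-# OPTIONS --safe #-}
-- Both rev and h are involutions, so M = h ∘ rev has inverse rev ∘ h, which is
-- rev ∘ M ∘ rev.  For h, the key fact is that h carries the right-hand side of
-- its own recursion back to a tree with first child h y: h (x ⊖ γ y) = h y ◂ h x.
module Submission where

open import Algebra.Definitions using (Involutive)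
open import Data.Product using (_×_; Σ-syntax; _,_)
open import Function using (_∘_)
open import Function.Definitions using (Inverseᵇ)
open import Relation.Binary.PropositionalEquality
  using (_≡_; _≢_; _≗_; refl; trans; cong; cong₂; module ≡-Reasoning)
open import Defs

open ≡-Reasoning

rev-⊕ : ∀ t u → rev (t ⊕ u) ≡ rev u ⊕ rev t
rev-⊕ e       u rewrite ⊕-identityʳ (rev u) = refl
rev-⊕ (s ◂ t) u rewrite rev-⊕ t u = ⊕-assoc (rev u) (rev t) (lam (rev s))

rev-involutive : Involutive _≡_ rev
rev-involutive e       = refl
rev-involutive (u ◂ v) =
  trans (rev-⊕ (rev v) (lam (rev u)))
        (cong₂ _◂_ (rev-involutive u) (rev-involutive v))

-- Since `h (b ◂ c)` unfolds to this form, it is nonempty, which `⊖-⊕` requires in `h-⊖-γ`.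
⊖-γ-≢e : ∀ x y → x ⊖ γ y ≢ e
⊖-γ-≢e e             e       ()
⊖-γ-≢e e             (_ ◂ _) ()
⊖-γ-≢e (_ ◂ e)       _       ()
⊖-γ-≢e (_ ◂ (_ ◂ _)) _       ()

-- By induction: `⊖` passes under a lone `lam`, so each further child of `t` leaves the outer `lam`
-- in place. This is the case `x = e` of `h-⊖-γ`.
h-γ : ∀ t → h (γ t) ≡ lam (h t)
h-γ e       = refl
h-γ (u ◂ v) = cong (_⊖ γ (h u)) (h-γ v)

h-⊖-γ : ∀ x y → h (x ⊖ γ y) ≡ h y ◂ h x
h-⊖-γ e             y = h-γ y
-- On a lone `lam z`, `h` reduces to `γ (h z)`; `γ` appends on the right, so the first child `h y`
-- survives.
h-⊖-γ (a ◂ e)       y = cong γ (h-⊖-γ a y)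
h-⊖-γ (a ◂ (b ◂ c)) y = begin
  h ((b ◂ c) ⊖ γ y) ⊖ γ (h a)     ≡⟨ cong (_⊖ γ (h a)) (h-⊖-γ (b ◂ c) y) ⟩
  -- `⊖` alters only the last child, and `h y` is not last because `h (b ◂ c)` is nonempty.
  (h y ◂ h (b ◂ c)) ⊖ γ (h a)     ≡⟨ ⊖-⊕ (lam (h y)) (h (b ◂ c)) (γ (h a))
                                        (λ ()) (⊖-γ-≢e (h c) (h b)) ⟩
  h y ◂ (h (b ◂ c) ⊖ γ (h a))     ∎

h-involutive : Involutive _≡_ h
h-involutive e       = refl
h-involutive (u ◂ v) =
  trans (h-⊖-γ (h v) (h u)) (cong₂ _◂_ (h-involutive u) (h-involutive v))

M-inverse : Inverseᵇ _≡_ _≡_ M (rev ∘ M ∘ rev)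
M-inverse = (λ { {x} refl → M∘M⁻¹ x }) , (λ { {x} refl → M⁻¹∘M x })
  where
  M∘M⁻¹ : ∀ t → M (rev (M (rev t))) ≡ t
  M∘M⁻¹ t = begin
    h (rev (rev (h (rev (rev t))))) ≡⟨ cong h (rev-involutive (h (rev (rev t)))) ⟩
    h (h (rev (rev t)))             ≡⟨ h-involutive (rev (rev t)) ⟩
    rev (rev t)                     ≡⟨ rev-involutive t ⟩
    t                               ∎

  M⁻¹∘M : ∀ t → rev (M (rev (M t))) ≡ t
  M⁻¹∘M t = begin
    rev (h (rev (rev (h (rev t))))) ≡⟨ cong (rev ∘ h) (rev-involutive (h (rev t))) ⟩
    rev (h (h (rev t)))             ≡⟨ cong rev (h-involutive (rev t)) ⟩
    rev (rev t)                     ≡⟨ rev-involutive t ⟩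
    t                               ∎

rev-inverse : Inverseᵇ _≡_ _≡_ rev rev
rev-inverse = (λ { refl → rev-involutive _ }) , (λ { refl → rev-involutive _ })

corollary5p6 : Σ[ M⁻¹ ∈ (Tree → Tree) ]
    ( Inverseᵇ _≡_ _≡_ M M⁻¹
    × M⁻¹ ≗ rev ∘ M ∘ rev
    × (Σ[ rev⁻¹ ∈ (Tree → Tree) ]
    ( Inverseᵇ _≡_ _≡_ rev rev⁻¹
    × M⁻¹ ≗ rev ∘ M ∘ rev⁻¹)))
corollary5p6 =
  -- With `rev` as its own inverse, the conjugate of `M` by `rev` is definitionally the chosen
  -- `M⁻¹`.
  rev ∘ M ∘ rev , M-inverse , (λ _ → refl) , rev , rev-inverse , (λ _ → refl)
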